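{- There is a morphism $h:\Sigma^*\to\Sigma^*$ over a binary alphabet $\Sigma$ that is abelian $16$-power free but not abelian $15$-power free, and that has an infinite fixed point which is abelian $14$-power free.
   Context: $\Sigma^*$ is the free monoid of finite words over $\Sigma$, with empty word $\epsilon$. A morphism is a monoid homomorphism $h:\Sigma^*\to\Sigma^*$; it extends to infinite words letter by letter, and an infinite word $\Omega$ is a fixed point of $h$ if $h(\Omega)=\Omega$. The Parikh vector $\psi(u)$ of a finite word $u$ records the number of occurrences of each letter in $u$. A word $u$ (finite or infinite) is abelian $k$-power free if whenever $u=xv_1\cdots v_ky$ with $\psi(v_1)=\cdots=\psi(v_k)$, one has $v_1=\cdots=v_k=\epsilon$. A morphism $h$ is abelian $n$-power free if $h(u)$ is abelian $n$-power free for every abelian $n$-power free word $u$. -}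

module Defs where

open import Algebra.Morphism.Structures using (module MonoidMorphisms)
open import Data.Fin.Base using (Fin)
open import Data.Fin.Properties using (_≟_)
open import Data.List.Base using (List; []; _∷_; _++_; concat; tabulate; filter; length; applyUpTo; ++-[]-rawMonoid)
open import Data.Nat.Base using (ℕ; zero; suc; _≤_)
open import Data.Product.Base using (_×_; ∃-syntax)
open import Data.Vec.Base as Vec using (Vec)
open import Relation.Binary.PropositionalEquality using (_≡_; _≗_)

private
  variable
    σ : ℕ

-- The alphabet with σ letters is Fin σ.
Word : ℕ → Set
Word σ = List (Fin σ)

-- The n-th letter of Ω, counting from 0, is Ω n.  Infinite words are
-- compared pointwise, by _≗_.
InfWord : ℕ → Set
InfWord σ = ℕ → Fin σ

infixr 5 _++∞_

_++∞_ : Word σ → InfWord σ → InfWord σ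
([]      ++∞ Ω) n       = Ω n
((a ∷ u) ++∞ Ω) zero    = a
((a ∷ u) ++∞ Ω) (suc n) = (u ++∞ Ω) n

record Morphism (σ : ℕ) : Set where
  open MonoidMorphisms (++-[]-rawMonoid (Fin σ)) (++-[]-rawMonoid (Fin σ))
  field
    ⟦_⟧                  : Word σ → Word σ
    isMonoidHomomorphism : IsMonoidHomomorphism ⟦_⟧

open Morphism public using (⟦_⟧)

ψ : Word σ → Vec ℕ σ
ψ u = Vec.tabulate λ a → length (filter (a ≟_) u)

AbelianPowerFree : ℕ → Word σ → Set
AbelianPowerFree {σ} k u =
  ∀ (x : Word σ) (v : Fin k → Word σ) (y : Word σ) →
  u ≡ x ++ concat (tabulate v) ++ y →
  (∀ i j → ψ (v i) ≡ ψ (v j)) →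
  ∀ i → v i ≡ []

AbelianPowerFree∞ : ℕ → InfWord σ → Set
AbelianPowerFree∞ {σ} k Ω =
  ∀ (x : Word σ) (v : Fin k → Word σ) (y : InfWord σ) →
  Ω ≗ x ++∞ concat (tabulate v) ++∞ y →
  (∀ i j → ψ (v i) ≡ ψ (v j)) →
  ∀ i → v i ≡ []

AbelianPowerFreeMorphism : ℕ → Morphism σ → Set
AbelianPowerFreeMorphism n h =
  ∀ u → AbelianPowerFree n u → AbelianPowerFree n (⟦ h ⟧ u)

_IsPrefixOf_ : Word σ → InfWord σ → Set
u IsPrefixOf Ω = applyUpTo Ω (length u) ≡ u

-- h(Ω) = Ω′, where h(Ω) is the concatenation h(Ω₀) h(Ω₁) h(Ω₂) ⋯, that is,
-- the limit of the images of the finite prefixes of Ω.  As h may erase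
-- letters, this concatenation need not be infinite; the second component
-- says that it is.
_MapsTo_To_ : Morphism σ → InfWord σ → InfWord σ → Set
h MapsTo Ω To Ω′ =
  (∀ n → ⟦ h ⟧ (applyUpTo Ω n) IsPrefixOf Ω′) ×
  (∀ m → ∃[ n ] m ≤ length (⟦ h ⟧ (applyUpTo Ω n)))

_IsFixedPointOf_ : InfWord σ → Morphism σ → Set
Ω IsFixedPointOf h = h MapsTo Ω To Ω

{-# OPTIONS --safe #-}
-- The morphism is h(0) = 0101010, h(1) = 0⁷10⁸, whose matrix M has determinant
-- −41.  Take an abelian k-power in h(u), with k ≥ 14.  The classes modulo Mℤ² of
-- the Parikh vectors of the prefixes of h(u) ending at its k + 1 cuts form an
-- arithmetic progression, inside the set A of the classes of prefixes of h(0)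
-- and h(1).  A finite check shows that 15 terms in A force the slope to be 0, 1
-- or −1; then the vector leading from a boundary between images of letters to
-- the cut, which depends on the class only, changes by a constant from each cut
-- to the next.  As M is injective, the corresponding boundaries cut out an
-- abelian k-power in u.  If u is abelian k-power free, these blocks are empty
-- and the power is trivial or 0ᵏ.
--
-- The longest progression of slope 1 in A has 16 terms, which excludes 0¹⁶; on
-- the other hand h(11) contains 0¹⁵.  In the fixed point 11 does not occur, and
-- its runs of 0 have at most 13 letters.
module Submission where

open import Defs
open import Data.Product.Base using (_×_; Σ-syntax)
open import Relation.Nullary.Negation.Core using (¬_)
open import Data.Bool.Base using (if_then_else_; T)
open import Data.Empty using (⊥; ⊥-elim)
open import Data.Fin.Base as Fin using (Fin; toℕ; fromℕ<)
open import Data.Fin.Patterns using (0F; 1F)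
import Data.Fin.Properties as Fin
open import Data.List.Base using (List; []; _∷_; _++_; [_]; concat; concatMap; tabulate; filter; length; take; drop; replicate; applyUpTo)
open import Data.List.Properties using (take-[]; filter-++; length-++; length-++-≤ˡ; ++-assoc; ++-identityʳ; concat-++; concatMap-++; take-suc-tabulate; take++drop≡id; tabulate-cong; length-applyUpTo; ∷-injectiveˡ; ∷-injectiveʳ)
open import Data.Maybe.Base using (Maybe; just; nothing)
import Data.Maybe.Properties as Maybe
open import Data.Maybe.Relation.Unary.All as All using (All; just)
open import Data.Maybe.Relation.Unary.Any as Any using (Any; just)
open import Data.Nat.Base
open import Data.Nat.DivMod
open import Data.Nat.Properties
open import Data.Nat.Tactic.RingSolver using (solve-∀)
open import Data.Product.Base using (_,_; proj₁; proj₂; ∃-syntax)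
import Data.Product.Properties as Product
open import Data.Sum.Base as Sum using (_⊎_; inj₁; inj₂; [_,_]′)
open import Data.Unit.Base using (⊤; tt)
open import Data.Vec.Base as Vec using ([]; _∷_)
open import Function.Base using (_∘_; id)
open import Relation.Binary.PropositionalEquality using (_≡_; _≢_; _≗_; refl; sym; trans; cong; cong₂; subst; subst₂; module ≡-Reasoning)
open import Relation.Nullary.Decidable using (Dec; yes; no; toWitness; _×-dec_; _⊎-dec_)
open import Relation.Nullary.Negation.Core using (contradiction)

private
  variable
    σ : ℕ

-- The morphism, classes of Parikh vectors, and anchors.

image : Fin 2 → Word 2
image 0F = 0F ∷ 1F ∷ 0F ∷ 1F ∷ 0F ∷ 1F ∷ 0F ∷ []
image 1F = replicate 7 0F ++ 1F ∷ replicate 8 0F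

h : Word 2 → Word 2
h = concatMap image

count : Fin 2 → Word 2 → ℕ
count a u = length (filter (a Fin.≟_) u)

zeros ones : Word 2 → ℕ
zeros = count 0F
ones  = count 1F

count-++ : ∀ a u v → count a (u ++ v) ≡ count a u + count a v
count-++ a u v = trans (cong length (filter-++ (a Fin.≟_) u v)) (length-++ (filter (a Fin.≟_) u))

-- Modulo 41 the weight vanishes on image 0F and image 1F, so the class is the
-- Parikh vector modulo the lattice spanned by (4 , 3) and (15 , 1).
weight : Word 2 → ℕ
weight u = zeros u + 26 * ones u

class : Word 2 → ℕ
class u = weight u % 41

-- The displacement of a cut from the boundary of an image it is attributed to,
-- shifted by (8 , 0) to avoid negative entries; the class of the cut determines
-- it.
anchor : ℕ → Maybe (ℕ × ℕ)
anchor c =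
  if      c ≤ᵇ 7  then just (c + 8 , 0)
  else if 33 ≤ᵇ c then just (c ∸ 33 , 0)
  else if 13 ≡ᵇ c then just (10 , 2)
  else if 14 ≡ᵇ c then just (11 , 2)
  else if 27 ≡ᵇ c then just (9 , 1)
  else if 28 ≡ᵇ c then just (10 , 1)
  else nothing

-- The coefficients are the rows of M. The 8 on the left compensates the shift in `anchor`.
AnchoredAt : Word 2 → Word 2 → ℕ × ℕ → Set
AnchoredAt p w (a , b) =
  zeros p + 8 ≡ 4 * zeros w + 15 * ones w + a ×
  ones p      ≡ 3 * zeros w +      ones w + b

-- `Any` makes this assert also that `anchor` is defined at the class of `p`, that is, that the
-- class lies in A.
Anchored : Word 2 → Word 2 → Set
Anchored p w = Any (AnchoredAt p w) (anchor (class p))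

anchored? : ∀ p w → Dec (Anchored p w)
anchored? p w = Any.dec (λ (a , b) → (_ ≟ _) ×-dec (_ ≟ _)) (anchor (class p))

-- The images have weights 82 and 41, so the class stays the same, and both sides of each equation
-- grow by the same entry of M.
anchored-∷ : ∀ a {p w} → Anchored p w → Anchored (image a ++ p) (a ∷ w)
anchored-∷ 0F {p} {w} anchored = Any.map step
    (subst (λ c → Any (AnchoredAt p w) (anchor c)) (sym class-eq) anchored)
  where
  weight-eq : ∀ z o → 4 + z + 26 * (3 + o) ≡ z + 26 * o + 2 * 41
  weight-eq = solve-∀
  zeros-eq : ∀ z o a → 4 + (4 * z + 15 * o + a) ≡ 4 * suc z + 15 * o + a
  zeros-eq = solve-∀
  ones-eq : ∀ z o b → 3 + (3 * z + o + b) ≡ 3 * suc z + o + b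
  ones-eq = solve-∀
  class-eq : class (image 0F ++ p) ≡ class p
  class-eq = trans (cong (_% 41) (weight-eq (zeros p) (ones p))) ([m+kn]%n≡m%n (weight p) 2 41)
  step : ∀ {r} → AnchoredAt p w r → AnchoredAt (image 0F ++ p) (0F ∷ w) r
  step {a , b} (e , f) =
    trans (cong (4 +_) e) (zeros-eq (zeros w) (ones w) a) ,
    trans (cong (3 +_) f) (ones-eq (zeros w) (ones w) b)
anchored-∷ 1F {p} {w} anchored = Any.map step
    (subst (λ c → Any (AnchoredAt p w) (anchor c)) (sym class-eq) anchored)
  where
  weight-eq : ∀ z o → 15 + z + 26 * (1 + o) ≡ z + 26 * o + 1 * 41
  weight-eq = solve-∀
  zeros-eq : ∀ z o a → 15 + (4 * z + 15 * o + a) ≡ 4 * z + 15 * suc o + a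
  zeros-eq = solve-∀
  ones-eq : ∀ z o b → 1 + (3 * z + o + b) ≡ 3 * z + suc o + b
  ones-eq = solve-∀
  class-eq : class (image 1F ++ p) ≡ class p
  class-eq = trans (cong (_% 41) (weight-eq (zeros p) (ones p))) ([m+kn]%n≡m%n (weight p) 1 41)
  step : ∀ {r} → AnchoredAt p w r → AnchoredAt (image 1F ++ p) (1F ∷ w) r
  step {a , b} (e , f) =
    trans (cong (15 +_) e) (zeros-eq (zeros w) (ones w) a) ,
    trans (cong (1 +_) f) (ones-eq (zeros w) (ones w) b)

-- Attributing cuts of the image to boundaries between letters.

-- A cut at a position t inside image a is attributed to the left end of the
-- image if t < mid a and to its right end otherwise.
mid : Fin 2 → ℕ
mid 0F = 6
mid 1F = 8

instance
  mid-nonZero : ∀ {a} → NonZero (mid a)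
  mid-nonZero {0F} = _
  mid-nonZero {1F} = _

cut : Word 2 → ℕ → ℕ
cut []      t = 0
cut (a ∷ u) t with t <? length (image a)
... | yes _ = t / mid a
... | no  _ = suc (cut u (t ∸ length (image a)))

t/mid≤1 : ∀ a t → t < length (image a) → t / mid a ≤ 1
t/mid≤1 0F t t<n = /-monoˡ-≤ 6 (s≤s⁻¹ t<n)
t/mid≤1 1F t t<n = /-monoˡ-≤ 8 (s≤s⁻¹ t<n)

cut-mono : ∀ u {s t} → s ≤ t → cut u s ≤ cut u t
cut-mono []      s≤t = z≤n
cut-mono (a ∷ u) {s} {t} s≤t with s <? length (image a) | t <? length (image a)
... | yes _   | yes _   = /-monoˡ-≤ (mid a) s≤t
... | yes s<n | no  _   = ≤-trans (t/mid≤1 a s s<n) (s≤s z≤n)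
... | no  s≮n | yes t<n = contradiction (≤-<-trans s≤t t<n) s≮n
... | no  _   | no  _   = s≤s (cut-mono u (∸-monoˡ-≤ (length (image a)) s≤t))

take-++-< : ∀ (u v : Word σ) {t} → t < length u → take t (u ++ v) ≡ take t u
take-++-< (a ∷ u) v {zero}  _         = refl
take-++-< (a ∷ u) v {suc t} (s≤s t<n) = cong (a ∷_) (take-++-< u v t<n)

take-++-≥ : ∀ (u v : Word σ) {t} → length u ≤ t → take t (u ++ v) ≡ u ++ take (t ∸ length u) v
take-++-≥ []      v _         = refl
take-++-≥ (a ∷ u) v (s≤s n≤t) = cong (a ∷_) (take-++-≥ u v n≤t)

take-≤1 : ∀ (a : Fin σ) u {n} → n ≤ 1 → take n [ a ] ≡ take n (a ∷ u)
take-≤1 a u {zero}  _ = refl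
take-≤1 a u {suc n} (s≤s z≤n) = refl

-- This check depends on the values of `mid`. Position 6 of h(0) and position 15 of h(1) share the
-- class 40, so both must go to the right end. Splitting h(1) just after its letter 1 leaves only
-- zeros between a cut and its boundary.
anchored-table : ∀ a (t : Fin (length (image a))) →
  Anchored (take (toℕ t) (image a)) (take (toℕ t / mid a) [ a ])
anchored-table 0F = toWitness {a? = Fin.all? λ t → anchored? (take (toℕ t) (image 0F)) (take (toℕ t / 6) [ 0F ])} tt
anchored-table 1F = toWitness {a? = Fin.all? λ t → anchored? (take (toℕ t) (image 1F)) (take (toℕ t / 8) [ 1F ])} tt

-- Whole images in front are stripped by `anchored-∷`; the table handles the image containing the
-- cut. A position past the end is attributed to the end of `u`.
anchored-cut : ∀ u t → Anchored (take t (h u)) (take (cut u t) u)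
anchored-cut [] t rewrite take-[] {A = Fin 2} t = just (refl , refl)
anchored-cut (a ∷ u) t with t <? length (image a)
... | yes t<n = subst₂ Anchored
        (trans (cong (λ s → take s (image a)) (Fin.toℕ-fromℕ< t<n)) (sym (take-++-< (image a) (h u) t<n)))
        (trans (cong (λ s → take (s / mid a) [ a ]) (Fin.toℕ-fromℕ< t<n)) (take-≤1 a u (t/mid≤1 a t t<n)))
        (anchored-table a (fromℕ< t<n))
... | no t≮n = subst (λ p → Anchored p (a ∷ take (cut u (t ∸ length (image a))) u))
        (sym (take-++-≥ (image a) (h u) (≮⇒≥ t≮n)))
        (anchored-∷ a (anchored-cut u (t ∸ length (image a))))

-- Arithmetic progressions of classes: the finite checks.

-- The displacement changes by (α - β, 0); two parameters avoid negative numbers.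
Drift : ℕ → ℕ → ℕ × ℕ → ℕ × ℕ → Set
Drift α β (a , b) (a′ , b′) = a + α ≡ a′ + β × b ≡ b′

Drifts : ℕ → ℕ → ℕ → Set
Drifts α β d = ∀ (c : Fin 41) →
  All (λ r → All (Drift α β r) (anchor ((toℕ c + d) % 41))) (anchor (toℕ c))

drifts? : ∀ α β d → Dec (Drifts α β d)
drifts? α β d = Fin.all? λ c →
  All.dec (λ r → All.dec (λ r′ → (_ ≟ _) ×-dec (_ ≟ _)) (anchor ((toℕ c + d) % 41))) (anchor (toℕ c))

data Slope (d : ℕ) : Set where
  level      : Drifts 0 0 d → Slope d
  ascending  : Drifts 1 0 d → Slope d
  descending : Drifts 0 1 d → Slope d

-- The 15 terms are the first 15 cuts of a power with at least 14 blocks; 40 stands for -1.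
escapes : ∀ (d c : Fin 41) → (toℕ d ≡ 0 ⊎ toℕ d ≡ 1 ⊎ toℕ d ≡ 40) ⊎
  (∃[ i ] anchor ((toℕ c + toℕ {15} i * toℕ d) % 41) ≡ nothing)
escapes = toWitness {a? = Fin.all? λ d → Fin.all? λ c →
  (_ ≟ _ ⊎-dec _ ≟ _ ⊎-dec _ ≟ _) ⊎-dec Fin.any? λ i → Maybe.≡-dec (Product.≡-dec _≟_ _≟_) _ _} tt

level-drifts : Drifts 0 0 0
level-drifts = toWitness {a? = drifts? 0 0 0} tt

ascending-drifts : Drifts 1 0 1
ascending-drifts = toWitness {a? = drifts? 1 0 1} tt

descending-drifts : Drifts 0 1 40
descending-drifts = toWitness {a? = drifts? 0 1 40} tt

small-slope : ∀ {d} → d ≡ 0 ⊎ d ≡ 1 ⊎ d ≡ 40 → Slope d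
small-slope (inj₁ refl)        = level level-drifts
small-slope (inj₂ (inj₁ refl)) = ascending ascending-drifts
small-slope (inj₂ (inj₂ refl)) = descending descending-drifts

slope : ∀ (d c : Fin 41) → Slope (toℕ d) ⊎
  (∃[ i ] anchor ((toℕ c + toℕ {15} i * toℕ d) % 41) ≡ nothing)
slope d c = Sum.map₁ small-slope (escapes d c)

-- The longest cyclic run of consecutive classes in A is 33, ..., 40, 0, ..., 7, of 16 terms,
-- whereas a 16th power has 17 cuts.
seventeen-escape : ∀ (c : Fin 41) → ∃[ i ] anchor ((toℕ c + toℕ {17} i * 1) % 41) ≡ nothing
seventeen-escape = toWitness {a? = Fin.all? λ c → Fin.any? λ i → Maybe.≡-dec (Product.≡-dec _≟_ _≟_) _ _} tt

residue : ℕ → Fin 41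
residue m = fromℕ< (m%n<n m 41)

toℕ-residue : ∀ m → toℕ (residue m) ≡ m % 41
toℕ-residue m = Fin.toℕ-fromℕ< (m%n<n m 41)

progression-% : ∀ m i e → (m + i * e) % 41 ≡ (toℕ (residue m) + i * toℕ (residue e)) % 41
progression-% m i e rewrite toℕ-residue m | toℕ-residue e = begin
  (m + i * e) % 41                            ≡⟨ %-distribˡ-+ m (i * e) 41 ⟩
  (m % 41 + i * e % 41) % 41                  ≡⟨ cong (λ r → (m % 41 + r) % 41) i*e ⟩
  (m % 41 + (i * (e % 41)) % 41) % 41         ≡⟨ cong (λ r → (r + (i * (e % 41)) % 41) % 41) (m%n%n≡m%n m 41) ⟨
  (m % 41 % 41 + (i * (e % 41)) % 41) % 41    ≡⟨ %-distribˡ-+ (m % 41) (i * (e % 41)) 41 ⟨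
  (m % 41 + i * (e % 41)) % 41                ∎
  where
  open ≡-Reasoning
  i*e : i * e % 41 ≡ (i * (e % 41)) % 41
  i*e = begin
    i * e % 41                      ≡⟨ %-distribˡ-* i e 41 ⟩
    (i % 41 * (e % 41)) % 41        ≡⟨ cong (λ r → (i % 41 * r) % 41) (m%n%n≡m%n e 41) ⟨
    (i % 41 * (e % 41 % 41)) % 41   ≡⟨ %-distribˡ-* i (e % 41) 41 ⟨
    (i * (e % 41)) % 41             ∎

-- Parikh vectors of the blocks between boundaries.

-- Subtracting the first equation from the second gives z = l + (a′ - a), and the drift says a′ - a
-- = α - β. Everything is cross-added to stay in ℕ.
balance : ∀ {p z L l a a′} α β → p ≡ L + a → p + z ≡ L + l + a′ → a + α ≡ a′ + β → l + α ≡ z + β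
balance {p} {z} {L} {l} {a} {a′} α β p≡ pz≡ drift = +-cancelˡ-≡ (L + a + a′) _ _ (begin
  L + a + a′ + (l + α)   ≡⟨ lhs L a a′ l α ⟩
  L + l + a′ + (a + α)   ≡⟨ cong₂ _+_ (sym pz≡) drift ⟩
  p + z + (a′ + β)       ≡⟨ cong (λ q → q + z + (a′ + β)) p≡ ⟩
  L + a + z + (a′ + β)   ≡⟨ rhs L a a′ z β ⟩
  L + a + a′ + (z + β)   ∎)
  where
  open ≡-Reasoning
  lhs : ∀ L a a′ l α → L + a + a′ + (l + α) ≡ L + l + a′ + (a + α)
  lhs = solve-∀
  rhs : ∀ L a a′ z β → L + a + z + (a′ + β) ≡ L + a + a′ + (z + β)
  rhs = solve-∀

ZerosOnes : Word 2 → ℕ → ℕ → Set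
ZerosOnes u z o = zeros u ≡ z × ones u ≡ o

-- Subtracting the anchor equations at the two ends of a block yields Mψ(b) = ψ(v) - (α - β, 0).
drift-block : ∀ α β {p v w b z o r r′} → ZerosOnes v z o →
  AnchoredAt p w r → AnchoredAt (p ++ v) (w ++ b) r′ → Drift α β r r′ →
  4 * zeros b + 15 * ones b + α ≡ z + β × 3 * zeros b + ones b ≡ o
drift-block α β {p} {v} {w} {b} {r = a , _} {a′ , c} (refl , refl) (ez , eo) (ez′ , eo′) (da , refl) =
  balance {p = zeros p + 8} {L = 4 * zeros w + 15 * ones w} {a = a} α β ez (begin
    zeros p + 8 + zeros v                                                ≡⟨ swap (zeros p) (zeros v) ⟩
    zeros p + zeros v + 8                                                ≡⟨ cong (_+ 8) (count-++ 0F p v) ⟨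
    zeros (p ++ v) + 8                                                   ≡⟨ ez′ ⟩
    4 * zeros (w ++ b) + 15 * ones (w ++ b) + a′
      ≡⟨ cong₂ (λ m n → 4 * m + 15 * n + a′) (count-++ 0F w b) (count-++ 1F w b) ⟩
    4 * (zeros w + zeros b) + 15 * (ones w + ones b) + a′
      ≡⟨ cong (_+ a′) (rearr (zeros w) (zeros b) (ones w) (ones b)) ⟩
    4 * zeros w + 15 * ones w + (4 * zeros b + 15 * ones b) + a′         ∎) da ,
  +-cancelʳ-≡ 0 _ _ (balance {p = ones p} {L = 3 * zeros w + ones w} {a = c} 0 0 eo (begin
    ones p + ones v                                    ≡⟨ count-++ 1F p v ⟨
    ones (p ++ v)                                      ≡⟨ eo′ ⟩
    3 * zeros (w ++ b) + ones (w ++ b) + c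
      ≡⟨ cong₂ (λ m n → 3 * m + n + c) (count-++ 0F w b) (count-++ 1F w b) ⟩
    3 * (zeros w + zeros b) + (ones w + ones b) + c
      ≡⟨ cong (_+ c) (rearr′ (zeros w) (zeros b) (ones w) (ones b)) ⟩
    3 * zeros w + ones w + (3 * zeros b + ones b) + c  ∎) refl)
  where
  open ≡-Reasoning
  swap : ∀ p v → p + 8 + v ≡ p + v + 8
  swap = solve-∀
  rearr : ∀ m m′ n n′ → 4 * (m + m′) + 15 * (n + n′) ≡ 4 * m + 15 * n + (4 * m′ + 15 * n′)
  rearr = solve-∀
  rearr′ : ∀ m m′ n n′ → 3 * (m + m′) + (n + n′) ≡ 3 * m + n + (3 * m′ + n′)
  rearr′ = solve-∀

-- The matrix (4 15; 3 1) has determinant −41.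
matrix-injective : ∀ a b a′ b′ → 4 * a + 15 * b ≡ 4 * a′ + 15 * b′ → 3 * a + b ≡ 3 * a′ + b′ →
  a ≡ a′ × b ≡ b′
matrix-injective a b a′ b′ e f = a≡a′ , +-cancelˡ-≡ (3 * a) b b′ (trans f (cong (λ n → 3 * n + b′) (sym a≡a′)))
  where
  cramer : ∀ a b → 4 * a + 15 * b + 41 * a ≡ 15 * (3 * a + b)
  cramer = solve-∀
  a≡a′ : a ≡ a′
  a≡a′ = *-cancelˡ-≡ a a′ 41 (+-cancelˡ-≡ (4 * a + 15 * b) _ _ (begin
    4 * a + 15 * b + 41 * a      ≡⟨ cramer a b ⟩
    15 * (3 * a + b)             ≡⟨ cong (15 *_) f ⟩
    15 * (3 * a′ + b′)           ≡⟨ cramer a′ b′ ⟨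
    4 * a′ + 15 * b′ + 41 * a′   ≡⟨ cong (_+ 41 * a′) e ⟨
    4 * a + 15 * b + 41 * a′     ∎))
    where open ≡-Reasoning

zeroless-oneless : ∀ u → ZerosOnes u 0 0 → u ≡ []
zeroless-oneless [] _ = refl
zeroless-oneless (0F ∷ u) (() , _)
zeroless-oneless (1F ∷ u) (_ , ())

single-zero : ∀ u → ZerosOnes u 1 0 → u ≡ [ 0F ]
single-zero [] (() , _)
single-zero (0F ∷ u) (z , o) = cong (0F ∷_) (zeroless-oneless u (suc-injective z , o))
single-zero (1F ∷ u) (_ , ())

-- Cutting a word at an increasing sequence of positions.

take-≤ : ∀ (u : Word σ) {m n} → m ≤ n → take n u ≡ take m u ++ drop m (take n u)
take-≤ u       {zero}  _         = refl
take-≤ []      {suc m} (s≤s _)   = refl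
take-≤ (a ∷ u) {suc m} (s≤s m≤n) = cong (a ∷_) (take-≤ u m≤n)

take-blocks : ∀ (u : Word σ) k (m : ℕ → ℕ) → (∀ i → m i ≤ m (suc i)) →
  take (m k) u ≡ take (m 0) u ++ concat (tabulate {n = k} λ i → drop (m (toℕ i)) (take (m (suc (toℕ i))) u))
take-blocks u zero    m mono = sym (++-identityʳ _)
take-blocks u (suc k) m mono = begin
  take (m (suc k)) u                     ≡⟨ take-blocks u k (m ∘ suc) (mono ∘ suc) ⟩
  take (m 1) u ++ rest                   ≡⟨ cong (_++ rest) (take-≤ u (mono 0)) ⟩
  (take (m 0) u ++ first) ++ rest        ≡⟨ ++-assoc (take (m 0) u) first rest ⟩
  take (m 0) u ++ first ++ rest          ∎
  where
  open ≡-Reasoning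
  first = drop (m 0) (take (m 1) u)
  rest  = concat (tabulate {n = k} λ i → drop (m (suc (toℕ i))) (take (m (suc (suc (toℕ i)))) u))

length-concat-take : ∀ i (vs : List (Word σ)) → length (concat (take i vs)) ≤ length (concat (take (suc i) vs))
length-concat-take zero    _        = z≤n
length-concat-take (suc i) []       = z≤n
length-concat-take (suc i) (v ∷ vs) rewrite length-++ v {concat (take i vs)} | length-++ v {concat (take (suc i) vs)} =
  +-monoʳ-≤ (length v) (length-concat-take i vs)

take-length-++ : ∀ (u v : Word σ) → take (length u) (u ++ v) ≡ u
take-length-++ []      v = refl
take-length-++ (a ∷ u) v = cong (a ∷_) (take-length-++ u v)

-- Pulling an abelian power in h(u) back to u.

module Power {k} (u x : Word 2) (v : Fin k → Word 2) (y : Word 2)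
  (split : h u ≡ x ++ concat (tabulate v) ++ y) {z o} (parikh : ∀ i → ZerosOnes (v i) z o) where

  prefix : ℕ → Word 2
  prefix i = x ++ concat (take i (tabulate v))

  prefix-suc : ∀ i → prefix (suc (toℕ i)) ≡ prefix (toℕ i) ++ v i
  prefix-suc i = begin
    x ++ concat (take (suc (toℕ i)) (tabulate v))             ≡⟨ cong (λ vs → x ++ concat vs) (take-suc-tabulate v i) ⟩
    x ++ concat (take (toℕ i) (tabulate v) ++ [ v i ])        ≡⟨ cong (x ++_) (concat-++ (take (toℕ i) (tabulate v)) [ v i ]) ⟨
    x ++ concat (take (toℕ i) (tabulate v)) ++ v i ++ []      ≡⟨ cong (λ w → x ++ concat (take (toℕ i) (tabulate v)) ++ w) (++-identityʳ (v i)) ⟩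
    x ++ concat (take (toℕ i) (tabulate v)) ++ v i            ≡⟨ ++-assoc x _ (v i) ⟨
    prefix (toℕ i) ++ v i                                     ∎
    where open ≡-Reasoning

  prefix-of-image : ∀ i → h u ≡ prefix i ++ concat (drop i (tabulate v)) ++ y
  prefix-of-image i = begin
    h u                                                          ≡⟨ split ⟩
    x ++ concat (tabulate v) ++ y                                ≡⟨ cong (λ vs → x ++ concat vs ++ y) (take++drop≡id i (tabulate v)) ⟨
    x ++ concat (before ++ after) ++ y                           ≡⟨ cong (λ w → x ++ w ++ y) (concat-++ before after) ⟨
    x ++ (concat before ++ concat after) ++ y                    ≡⟨ cong (x ++_) (++-assoc (concat before) (concat after) y) ⟩
    x ++ concat before ++ concat after ++ y                      ≡⟨ ++-assoc x (concat before) (concat after ++ y) ⟨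
    prefix i ++ concat after ++ y                                ∎
    where
    open ≡-Reasoning
    before = take i (tabulate v)
    after  = drop i (tabulate v)

  position : ℕ → ℕ
  position i = cut u (length (prefix i))

  position-mono : ∀ i → position i ≤ position (suc i)
  position-mono i = cut-mono u (subst₂ _≤_ (sym (length-++ x)) (sym (length-++ x))
    (+-monoʳ-≤ (length x) (length-concat-take i (tabulate v))))

  anchored : ∀ i → Anchored (prefix i) (take (position i) u)
  anchored i = subst (λ p → Anchored p (take (position i) u))
    (trans (cong (take (length (prefix i))) (prefix-of-image i)) (take-length-++ (prefix i) _))
    (anchored-cut u (length (prefix i)))

  step : ℕ
  step = z + 26 * o

  weight-suc : ∀ i → weight (prefix (suc (toℕ i))) ≡ weight (prefix (toℕ i)) + step
  weight-suc i rewrite prefix-suc i | count-++ 0F (prefix (toℕ i)) (v i) | count-++ 1F (prefix (toℕ i)) (v i)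
    | proj₁ (parikh i) | proj₂ (parikh i) = rearr (zeros (prefix (toℕ i))) z (ones (prefix (toℕ i))) o
    where
    rearr : ∀ m z n o → m + z + 26 * (n + o) ≡ m + 26 * n + (z + 26 * o)
    rearr = solve-∀

  weight-prefix : ∀ i → i ≤ k → weight (prefix i) ≡ weight (prefix 0) + i * step
  weight-prefix zero    _   = sym (+-identityʳ _)
  weight-prefix (suc i) i<k = begin
    weight (prefix (suc i))                     ≡⟨ cong (weight ∘ prefix ∘ suc) (Fin.toℕ-fromℕ< i<k) ⟨
    weight (prefix (suc (toℕ j)))               ≡⟨ weight-suc j ⟩
    weight (prefix (toℕ j)) + step              ≡⟨ cong (λ n → weight (prefix n) + step) (Fin.toℕ-fromℕ< i<k) ⟩
    weight (prefix i) + step                    ≡⟨ cong (_+ step) (weight-prefix i (<⇒≤ i<k)) ⟩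
    weight (prefix 0) + i * step + step         ≡⟨ rearr (weight (prefix 0)) (i * step) step ⟩
    weight (prefix 0) + suc i * step            ∎
    where
    open ≡-Reasoning
    j = fromℕ< i<k
    rearr : ∀ a b c → a + b + c ≡ a + (c + b)
    rearr = solve-∀

  -- `anchored` puts the class of the i-th cut into A, and this class is the i-th term of the
  -- progression.
  never-escapes : ∀ i → i ≤ k →
    anchor ((toℕ (residue (weight (prefix 0))) + i * toℕ (residue step)) % 41) ≡ nothing → ⊥
  never-escapes i i≤k escape = ¬Any-nothing (subst (Any (AnchoredAt (prefix i) (take (position i) u))) eq (anchored i))
    where
    eq : anchor (class (prefix i)) ≡ nothing
    eq = trans (cong anchor (trans (cong (_% 41) (weight-prefix i i≤k)) (progression-% (weight (prefix 0)) i step))) escape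
    ¬Any-nothing : ∀ {P : ℕ × ℕ → Set} → Any P nothing → ⊥
    ¬Any-nothing ()

  no-unit-slope : 16 ≤ k → toℕ (residue step) ≡ 1 → ⊥
  no-unit-slope 16≤k unit =
    let j , escape = seventeen-escape (residue (weight (prefix 0)))
    in never-escapes (toℕ j) (≤-trans (s≤s⁻¹ (Fin.toℕ<n j)) 16≤k)
         (subst (λ d → anchor ((toℕ (residue (weight (prefix 0))) + toℕ j * d) % 41) ≡ nothing) (sym unit) escape)

  -- Monotonicity of `position` makes these consecutive factors of `u`. A block is empty when two
  -- cuts share a boundary.
  block : Fin k → Word 2
  block i = drop (position (toℕ i)) (take (position (suc (toℕ i))) u)

  blocks : u ≡ take (position 0) u ++ concat (tabulate block) ++ drop (position k) u
  blocks = begin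
    u                                                                        ≡⟨ take++drop≡id (position k) u ⟨
    take (position k) u ++ drop (position k) u
      ≡⟨ cong (_++ drop (position k) u) (take-blocks u k position position-mono) ⟩
    (take (position 0) u ++ concat (tabulate block)) ++ drop (position k) u
      ≡⟨ ++-assoc (take (position 0) u) (concat (tabulate block)) _ ⟩
    take (position 0) u ++ concat (tabulate block) ++ drop (position k) u    ∎
    where open ≡-Reasoning

  -- The outcome is the same for all `i`: M applied to the Parikh vector of a block is constant.
  block-parikh : ∀ α β → Drifts α β (toℕ (residue step)) → ∀ i →
    4 * zeros (block i) + 15 * ones (block i) + α ≡ z + β × 3 * zeros (block i) + ones (block i) ≡ o
  block-parikh α β drifts i =
    combine (anchored (toℕ i))
      (subst₂ (λ p w → Any (AnchoredAt p w) (anchor ((toℕ c + toℕ (residue step)) % 41)))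
        (prefix-suc i) (take-≤ u (position-mono (toℕ i)))
        (subst (λ n → Any (AnchoredAt (prefix (suc (toℕ i))) (take (position (suc (toℕ i))) u)) (anchor n))
          class-suc (anchored (suc (toℕ i)))))
      (subst (λ n → All (λ r → All (Drift α β r) (anchor ((toℕ c + toℕ (residue step)) % 41))) (anchor n))
        (toℕ-residue (weight (prefix (toℕ i)))) (drifts c))
    where
    c = residue (weight (prefix (toℕ i)))
    class-suc : class (prefix (suc (toℕ i))) ≡ (toℕ c + toℕ (residue step)) % 41
    class-suc = begin
      weight (prefix (suc (toℕ i))) % 41                       ≡⟨ cong (_% 41) (weight-suc i) ⟩
      (weight (prefix (toℕ i)) + step) % 41                    ≡⟨ %-distribˡ-+ (weight (prefix (toℕ i))) step 41 ⟩
      (weight (prefix (toℕ i)) % 41 + step % 41) % 41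
        ≡⟨ cong₂ (λ m n → (m + n) % 41) (toℕ-residue (weight (prefix (toℕ i)))) (toℕ-residue step) ⟨
      (toℕ c + toℕ (residue step)) % 41                        ∎
      where open ≡-Reasoning
    combine : ∀ {m m′} →
      Any (AnchoredAt (prefix (toℕ i)) (take (position (toℕ i)) u)) m →
      Any (AnchoredAt (prefix (toℕ i) ++ v i) (take (position (toℕ i)) u ++ block i)) m′ →
      All (λ r → All (Drift α β r) m′) m →
      4 * zeros (block i) + 15 * ones (block i) + α ≡ z + β × 3 * zeros (block i) + ones (block i) ≡ o
    combine (just at) (just at′) (just (just drift)) =
      drift-block α β {p = prefix (toℕ i)} {v = v i} {w = take (position (toℕ i)) u} (parikh i) at at′ drift

  -- By `matrix-injective` the blocks form an abelian k-power in `u`, hence are empty. Substituting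
  -- the empty word into `block-parikh` determines `z` and `o`.
  blocks-empty : AbelianPowerFree k u → ∀ α β → Drifts α β (toℕ (residue step)) → Fin k → α ≡ z + β × 0 ≡ o
  blocks-empty free α β drifts i = subst (λ w → 4 * zeros w + 15 * ones w + α ≡ z + β × 3 * zeros w + ones w ≡ o)
    (free (take (position 0) u) block (drop (position k) u) blocks same-parikh i) (block-parikh α β drifts i)
    where
    same-parikh : ∀ i j → ψ (block i) ≡ ψ (block j)
    same-parikh i j =
      let e  , f  = block-parikh α β drifts i
          e′ , f′ = block-parikh α β drifts j
          zeros≡ , ones≡ = matrix-injective
            (zeros (block i)) (ones (block i)) (zeros (block j)) (ones (block j))
            (+-cancelʳ-≡ α (4 * zeros (block i) + 15 * ones (block i)) (4 * zeros (block j) + 15 * ones (block j))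
              (trans e (sym e′)))
            (trans f (sym f′))
      in cong₂ (λ m n → m ∷ n ∷ []) zeros≡ ones≡

  conclude : AbelianPowerFree k u → Fin k → Slope (toℕ (residue step)) →
    (∀ i → v i ≡ []) ⊎ (∀ i → v i ≡ [ 0F ])
  conclude free i (level drifts) =
    let 0≡z+0 , 0≡o = blocks-empty free 0 0 drifts i
        z≡0 = trans (sym (+-identityʳ z)) (sym 0≡z+0)
    in inj₁ λ j → zeroless-oneless (v j) (trans (proj₁ (parikh j)) z≡0 , trans (proj₂ (parikh j)) (sym 0≡o))
  conclude free i (ascending drifts) =
    let 1≡z+0 , 0≡o = blocks-empty free 1 0 drifts i
        z≡1 = trans (sym (+-identityʳ z)) (sym 1≡z+0)
    in inj₂ λ j → single-zero (v j) (trans (proj₁ (parikh j)) z≡1 , trans (proj₂ (parikh j)) (sym 0≡o))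
  -- Slope -1 would require blocks with -1 zeros.
  conclude free i (descending drifts) =
    let 0≡z+1 , _ = blocks-empty free 0 1 drifts i
    in contradiction (trans 0≡z+1 (+-comm z 1)) λ ()

  periods : 14 ≤ k → AbelianPowerFree k u → Fin k → (∀ i → v i ≡ []) ⊎ (∀ i → v i ≡ [ 0F ])
  periods 14≤k free i =
    [ conclude free i
    -- The escaping index is at most 14, so it is the index of an actual cut.
    , (λ (j , escape) → ⊥-elim (never-escapes (toℕ j) (≤-trans (s≤s⁻¹ (Fin.toℕ<n j)) 14≤k) escape))
    ]′ (slope (residue step) (residue (weight (prefix 0))))

parikh-zeros-ones : ∀ {u v : Word 2} → ψ u ≡ ψ v → ZerosOnes u (zeros v) (ones v)
parikh-zeros-ones e = cong Vec.head e , cong (Vec.head ∘ Vec.tail) e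

image-periods : ∀ {k} → 14 ≤ k → ∀ {u} → AbelianPowerFree k u →
  ∀ x (v : Fin k → Word 2) y → h u ≡ x ++ concat (tabulate v) ++ y → (∀ i j → ψ (v i) ≡ ψ (v j)) →
  (∀ i → v i ≡ []) ⊎ (∀ i → v i ≡ [ 0F ])
image-periods {suc k} 14≤k {u} free x v y split same =
  -- The common Parikh vector is read off the first block, which exists as there are at least 14.
  Power.periods u x v y split (λ i → parikh-zeros-ones {v i} {v 0F} (same i 0F)) 14≤k free 0F

unit-residue : toℕ (residue 1) ≡ 1
unit-residue = refl

-- If all blocks are `[ 0F ]`, the slope is 1 and the 17 cuts exceed the longest progression of that
-- slope in A.
h-16-free : ∀ u → AbelianPowerFree 16 u → AbelianPowerFree 16 (h u)
h-16-free u free x v y split same =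
  [ id
  , (λ zero-letters → ⊥-elim (Power.no-unit-slope u x v y split {1} {0} (parikh zero-letters) ≤-refl unit-residue))
  ]′ (image-periods (m≤m+n 14 2) free x v y split same)
  where
  parikh : (∀ i → v i ≡ [ 0F ]) → ∀ i → ZerosOnes (v i) 1 0
  parikh zero-letters i rewrite zero-letters i = refl , refl

-- Excluding long runs of 0 in images.

-- The factor 11 and runs of more than 13 letters 0 do not occur in u when it is
-- read after a run of r letters 0, or after a letter 1 if r = 0.
Gap : ℕ → Word 2 → Set
Gap r []       = ⊤
Gap r (0F ∷ u) = T (r <ᵇ 13) × Gap (suc r) u
Gap r (1F ∷ u) = T (0 <ᵇ r) × Gap 0 u

-- The image of a preceding 1 ends in 0⁸, that of a preceding 0 in 10. Without the factor 11, h(1)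
-- is followed only by h(0), which makes a run of 8 + 1 zeros; after h(0) a run reaches at most 1 +
-- 7.
gap-image : ∀ u → (Gap 0 u → Gap 8 (h u)) × (∀ r → Gap (suc r) u → Gap 1 (h u))
gap-image [] = _
gap-image (0F ∷ u) =
  (λ (_ , g) → _ , _ , _ , _ , _ , _ , _ , proj₂ (gap-image u) _ g) ,
  (λ r (_ , g) → _ , _ , _ , _ , _ , _ , _ , proj₂ (gap-image u) _ g)
gap-image (1F ∷ u) =
  (λ ()) ,
  (λ r (_ , g) → _ , _ , _ , _ , _ , _ , _ , _ , _ , _ , _ , _ , _ , _ , _ , _ , proj₁ (gap-image u) g)

gap-excludes : ∀ r x y → Gap r (x ++ replicate 14 0F ++ y) → ⊥
-- The fourteenth 0 is read after at least 13 others.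
gap-excludes r [] y (_ , _ , _ , _ , _ , _ , _ , _ , _ , _ , _ , _ , _ , () , _)
gap-excludes r (0F ∷ x) y (_ , g) = gap-excludes (suc r) x y g
gap-excludes r (1F ∷ x) y (_ , g) = gap-excludes 0 x y g

h-14-free : ∀ u → Gap 1 (h u) → AbelianPowerFree 14 u → AbelianPowerFree 14 (h u)
h-14-free u gap free x v y split same =
  [ id
  , (λ zero-letters → ⊥-elim (gap-excludes 1 x y (subst (Gap 1)
      (trans split (cong (λ vs → x ++ concat vs ++ y) (tabulate-cong zero-letters))) gap)))
  ]′ (image-periods ≤-refl free x v y split same)

-- Short words are power free; failure for exponent 15.

length-concat : ∀ k (v : Fin k → Word σ) → (∀ i → v i ≢ []) → k ≤ length (concat (tabulate v))
length-concat zero    v nonempty = z≤n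
length-concat (suc k) v nonempty with v 0F in eq
... | []    = contradiction eq (nonempty 0F)
... | a ∷ w = s≤s (≤-trans (length-concat k (v ∘ Fin.suc) (nonempty ∘ Fin.suc))
                (≤-trans (m≤n+m _ (length w)) (≤-reflexive (sym (length-++ w)))))

-- If one block is nonempty, all are, since their Parikh vectors agree; then they have at least `k`
-- letters together.
short-free : ∀ {k} u → length u < k → AbelianPowerFree k u
short-free {k} u short x v y split same i with v i in eq
... | [] = refl
... | a ∷ w = contradiction (≤-<-trans k≤ short) (<-irrefl refl)
  where
  nonempty : ∀ j → v j ≢ []
  nonempty j e with trans (sym eq) (zeroless-oneless (v i) (parikh-zeros-ones {v i} {[]} (trans (same i j) (cong ψ e))))
  ... | ()
  k≤ : k ≤ length u
  k≤ = begin
    k                                                              ≤⟨ length-concat k v nonempty ⟩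
    length (concat (tabulate v))                                   ≤⟨ length-++-≤ˡ (concat (tabulate v)) ⟩
    length (concat (tabulate v) ++ y)                              ≤⟨ m≤n+m _ (length x) ⟩
    length x + length (concat (tabulate v) ++ y)                   ≡⟨ length-++ x ⟨
    length (x ++ concat (tabulate v) ++ y)                         ≡⟨ cong length split ⟨
    length u                                                       ∎
    where open ≤-Reasoning

not-15-free : ¬ (∀ u → AbelianPowerFree 15 u → AbelianPowerFree 15 (h u))
not-15-free free = contradiction
  -- h(11) = 0⁷1 0¹⁵ 10⁸, where the 15 zeros arise as 8 + 7.
  (free (1F ∷ 1F ∷ []) (short-free _ (m≤m+n 3 12))
    (replicate 7 0F ++ [ 1F ]) (λ _ → [ 0F ]) (1F ∷ replicate 8 0F) refl (λ _ _ → refl) 0F)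
  λ ()

-- The iterates of h on 0 and their limit.

iterate : ℕ → Word 2
iterate zero    = [ 0F ]
iterate (suc n) = h (iterate n)

-- The index 1 treats the word as if a single 0 preceded it, a condition that `gap-image` preserves.
iterate-gap : ∀ n → Gap 1 (iterate n)
iterate-gap zero    = _
iterate-gap (suc n) = proj₂ (gap-image (iterate n)) 0 (iterate-gap n)

iterate-free : ∀ n → AbelianPowerFree 14 (iterate n)
iterate-free zero    = short-free _ (m≤m+n 2 12)
iterate-free (suc n) = h-14-free (iterate n) (iterate-gap (suc n)) (iterate-free n)

h-++ : ∀ u v → h (u ++ v) ≡ h u ++ h v
h-++ = concatMap-++ image

length-h : ∀ u → length u ≤ length (h u)
length-h []       = z≤n
length-h (0F ∷ u) = s≤s (≤-trans (length-h u) (m≤n+m _ 6))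
length-h (1F ∷ u) = s≤s (≤-trans (length-h u) (m≤n+m _ 15))

-- h(0) properly extends 0; applying h keeps the prefix relation and does not shorten the remainder.
iterate-suc : ∀ n → ∃[ s ] iterate (suc n) ≡ iterate n ++ s × 0 < length s
iterate-suc zero = _ , refl , z<s
iterate-suc (suc n) =
  let s , eq , 0<s = iterate-suc n
  in h s , trans (cong h eq) (h-++ (iterate n) s) , <-≤-trans 0<s (length-h s)

iterate-+ : ∀ n m → ∃[ s ] iterate (m + n) ≡ iterate n ++ s
iterate-+ n zero    = [] , sym (++-identityʳ _)
iterate-+ n (suc m) =
  let s , eq = iterate-+ n m
      t , eq′ , _ = iterate-suc (m + n)
  in s ++ t , trans eq′ (trans (cong (_++ t) eq) (++-assoc (iterate n) s t))

length-iterate : ∀ n → n < length (iterate n)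
length-iterate zero    = z<s
length-iterate (suc n) = let s , eq , 0<s = iterate-suc n in begin-strict
  suc n                           ≤⟨ length-iterate n ⟩
  length (iterate n)              ≡⟨ +-identityʳ _ ⟨
  length (iterate n) + 0          <⟨ +-monoʳ-< (length (iterate n)) 0<s ⟩
  length (iterate n) + length s   ≡⟨ length-++ (iterate n) ⟨
  length (iterate n ++ s)         ≡⟨ cong length eq ⟨
  length (iterate (suc n))        ∎
  where open ≤-Reasoning

-- The padding by 0 only makes this total: `Ω` reads inside the word, by `length-iterate`.
letter : Word 2 → ℕ → Fin 2
letter u n = (u ++∞ λ _ → 0F) n

letter-++ : ∀ u s {n} → n < length u → letter (u ++ s) n ≡ letter u n
letter-++ (a ∷ u) s {zero}  _         = refl
letter-++ (a ∷ u) s {suc n} (s≤s n<u) = letter-++ u s n<u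

Ω : InfWord 2
Ω n = letter (iterate n) n

-- Of `iterate i` and `iterate n` one is a prefix of the other, so the diagonal choice in `Ω` agrees
-- with every iterate.
letter-iterate : ∀ n i → i < length (iterate n) → Ω i ≡ letter (iterate n) i
letter-iterate n i i<n with ≤-total i n
... | inj₁ i≤n = let s , eq = iterate-+ i (n ∸ i) in
  sym (trans (cong (λ w → letter w i) (trans (cong iterate (sym (m∸n+n≡m i≤n))) eq))
    (letter-++ (iterate i) s (length-iterate i)))
... | inj₂ n≤i = let s , eq = iterate-+ n (i ∸ n) in
  trans (cong (λ w → letter w i) (trans (cong iterate (sym (m∸n+n≡m n≤i))) eq))
    (letter-++ (iterate n) s i<n)

letters-prefix : ∀ u (X : InfWord 2) → (∀ i → i < length u → X i ≡ letter u i) → u IsPrefixOf X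
letters-prefix []      X _   = refl
letters-prefix (a ∷ u) X eq = cong₂ _∷_ (eq 0 z<s) (letters-prefix u (X ∘ suc) (λ i i<u → eq (suc i) (s≤s i<u)))

iterate-prefix : ∀ n → iterate n IsPrefixOf Ω
iterate-prefix n = letters-prefix (iterate n) Ω (letter-iterate n)

applyUpTo-+ : ∀ (X : InfWord σ) m n → applyUpTo X (m + n) ≡ applyUpTo X m ++ applyUpTo (X ∘ (m +_)) n
applyUpTo-+ X zero    n = refl
applyUpTo-+ X (suc m) n = cong (X 0 ∷_) (applyUpTo-+ (X ∘ suc) m n)

prefix-++ : ∀ (u s : Word σ) {X : InfWord σ} → (u ++ s) IsPrefixOf X → u IsPrefixOf X
prefix-++ []      s eq = refl
prefix-++ (a ∷ u) s eq = cong₂ _∷_ (∷-injectiveˡ eq) (prefix-++ u s (∷-injectiveʳ eq))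

Ω-iterate : ∀ n → ∃[ s ] iterate n ≡ applyUpTo Ω n ++ s
Ω-iterate n = _ , (begin
  iterate n                                                          ≡⟨ iterate-prefix n ⟨
  applyUpTo Ω (length (iterate n))                                   ≡⟨ cong (applyUpTo Ω) (m+[n∸m]≡n (<⇒≤ (length-iterate n))) ⟨
  applyUpTo Ω (n + (length (iterate n) ∸ n))                         ≡⟨ applyUpTo-+ Ω n _ ⟩
  applyUpTo Ω n ++ applyUpTo (Ω ∘ (n +_)) (length (iterate n) ∸ n)   ∎)
  where open ≡-Reasoning

morphism : Morphism 2
morphism = record
  { ⟦_⟧ = h
  ; isMonoidHomomorphism = record
    { isMagmaHomomorphism = record
      { isRelHomomorphism = record { cong = cong h }
      ; homo = h-++
      }
    ; ε-homo = refl
    }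
  }

-- A prefix of `Ω` of length n is a prefix of `iterate n`, so its image is a prefix of
-- `iterate (suc n)`, hence of `Ω`.
Ω-fixed : Ω IsFixedPointOf morphism
Ω-fixed = image-prefix , λ m → m , ≤-trans (≤-reflexive (sym (length-applyUpTo Ω m))) (length-h (applyUpTo Ω m))
  where
  image-prefix : ∀ n → h (applyUpTo Ω n) IsPrefixOf Ω
  image-prefix n = let s , eq = Ω-iterate n in
    prefix-++ (h (applyUpTo Ω n)) (h s)
      (subst (_IsPrefixOf Ω) (trans (cong h eq) (h-++ (applyUpTo Ω n) s)) (iterate-prefix (suc n)))

-- Passing from finite to infinite words.

applyUpTo-++∞ : ∀ (u : Word σ) X → applyUpTo (u ++∞ X) (length u) ≡ u
applyUpTo-++∞ []      X = refl
applyUpTo-++∞ (a ∷ u) X = cong (a ∷_) (applyUpTo-++∞ u X)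

applyUpTo-cong : ∀ {X Y : InfWord σ} → X ≗ Y → ∀ n → applyUpTo X n ≡ applyUpTo Y n
applyUpTo-cong eq zero    = refl
applyUpTo-cong eq (suc n) = cong₂ _∷_ (eq 0) (applyUpTo-cong (eq ∘ suc) n)

++∞-assoc : ∀ (u v : Word σ) X → u ++∞ v ++∞ X ≗ (u ++ v) ++∞ X
++∞-assoc []      v X n       = refl
++∞-assoc (a ∷ u) v X zero    = refl
++∞-assoc (a ∷ u) v X (suc n) = ++∞-assoc u v X n

-- A power in `Ω` ends within a finite prefix, hence occurs in an iterate; the infinite tail `y` is
-- replaced by the rest `s` of that iterate.
Ω-free : AbelianPowerFree∞ 14 Ω
Ω-free x v y split same = let s , eq = Ω-iterate n in
  iterate-free n x v s (trans eq (trans (cong (_++ s) prefix) (++-assoc x (concat (tabulate v)) s))) same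
  where
  w = x ++ concat (tabulate v)
  n = length w
  prefix : applyUpTo Ω n ≡ w
  prefix = trans (applyUpTo-cong (λ i → trans (split i) (++∞-assoc x (concat (tabulate v)) y i)) n) (applyUpTo-++∞ w y)

theorem3p8 : Σ[ h ∈ Morphism 2 ]
    ( AbelianPowerFreeMorphism 16 h
    × ¬ AbelianPowerFreeMorphism 15 h
    × (Σ[ Ω ∈ InfWord 2 ] (Ω IsFixedPointOf h × AbelianPowerFree∞ 14 Ω)) )
theorem3p8 = morphism , h-16-free , not-15-free , Ω , Ω-fixed , Ω-free
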